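{- There is a constant $c>1/2$ such that for every prime $p$ there exists $n_0=n_0(p)$ such that for every integer $n\ge n_0$ there exists a subset $A\subseteq \mathbb{F}_p^n$ of size $|A|\ge (cp)^n$ not containing a three-term arithmetic progression. (The constant $c$ is absolute, i.e. independent of $p$ and $n$.)
   Context: A three-term arithmetic progression in $\mathbb{F}_p^n$ consists of three distinct elements $x,y,z\in \mathbb{F}_p^n$ with $x-2y+z=0$. A subset $A$ does not contain a three-term arithmetic progression if there are no three (pairwise) distinct elements $x,y,z\in A$ with $x-2y+z=0$. -}

module Defs where

open import Data.Fin.Base using (Fin; toℕ)
open import Data.List.Base using (List)
open import Data.List.Membership.Propositional using (_∈_)
open import Data.Nat.Base as ℕ using (ℕ; NonZero)
open import Data.Nat.DivMod using (_mod_)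
open import Data.Product.Base using (_×_)
open import Data.Vec.Base using (Vec; map; zipWith; replicate)
open import Relation.Binary.PropositionalEquality.Core using (_≡_; _≢_)
open import Relation.Nullary.Negation.Core using (¬_)

-- The integers modulo p, represented by the residues 0, …, p - 1; this is
-- the field with p elements when p is prime.
𝔽 : ℕ → Set
𝔽 p = Fin p

𝔽^ : ℕ → ℕ → Set
𝔽^ p n = Vec (𝔽 p) n

module _ {p : ℕ} .{{_ : NonZero p}} where

  infixl 6 _+ₚ_
  infixl 7 _*ₚ_
  infix  8 -ₚ_

  fromℕₚ : ℕ → 𝔽 p
  fromℕₚ k = k mod p

  _+ₚ_ _*ₚ_ : 𝔽 p → 𝔽 p → 𝔽 p
  x +ₚ y = fromℕₚ (toℕ x ℕ.+ toℕ y)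
  x *ₚ y = fromℕₚ (toℕ x ℕ.* toℕ y)

  -ₚ_ : 𝔽 p → 𝔽 p
  -ₚ x = fromℕₚ (p ℕ.∸ toℕ x)

  module _ {n : ℕ} where

    infixl 6 _+ᵥ_ _-ᵥ_
    infixr 7 _·ᵥ_

    0ᵥ : 𝔽^ p n
    0ᵥ = replicate n (fromℕₚ 0)

    _+ᵥ_ _-ᵥ_ : 𝔽^ p n → 𝔽^ p n → 𝔽^ p n
    _+ᵥ_ = zipWith _+ₚ_
    u -ᵥ v = u +ᵥ map -ₚ_ v

    _·ᵥ_ : 𝔽 p → 𝔽^ p n → 𝔽^ p n
    a ·ᵥ v = map (a *ₚ_) v

    IsThreeTermAP : 𝔽^ p n → 𝔽^ p n → 𝔽^ p n → Set
    IsThreeTermAP x y z =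
      x ≢ y × y ≢ z × x ≢ z × x -ᵥ fromℕₚ 2 ·ᵥ y +ᵥ z ≡ 0ᵥ

    -- A finite subset is given by a list of its elements; its cardinality is
    -- the length of the list only when the list is also duplicate-free.
    ThreeTermAPFree : List (𝔽^ p n) → Set
    ThreeTermAPFree A =
      ∀ {x y z} → x ∈ A → y ∈ A → z ∈ A → ¬ IsThreeTermAP x y z

{-# OPTIONS --safe #-}
-- A function f on S ⊆ 𝔽ₚ² with 2 f(y) < f(x) + f(z) for every non-constant solution of
-- x + z = 2y in S makes each level set of Σ f on Sᵐ progression-free, and by pigeonhole
-- some level set has at least |S|ᵐ / (1 + m max f) elements. So it suffices to find such
-- S of size at least (1/4 + ε) p². For p = 2h + 1 take f(i, y) = 2p² i² + y² on residues
-- in [0, p). It is convex on progressions with i₁ + i₃ ≥ 2i₂, so only those with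
-- i₁ + i₃ + p = 2i₂ must be kept out of S. The square i ≤ h, y ∈ 2·[0, h] has none, and
-- ((h + 1)/p)² suffices for bounded p. For large p the square is traded for a set that
-- has columns i > h as well: where i₂ is such a column, the columns i₁, i₃ (which are
-- then small) are shortened so that the sumset of their y misses twice the y's of i₂.
-- For p = 2 the whole space is progression-free.
module Submission where

module Construction where

  open import Algebra.Bundles using (CommutativeMonoid)
  open import Data.Fin.Base using (toℕ; zero; suc)
  import Data.Fin.Properties as Fin
  import Data.Integer.Base as ℤ
  import Data.Integer.Properties as ℤ
  open import Data.List.Base using (List; []; _∷_; [_]; length; filter; map; cartesianProductWith; _++_; upTo; allFin)
  open import Data.List.Membership.Propositional using (_∈_)
  open import Data.List.Membership.Propositional.Properties using (∈-cartesianProductWith⁻; ∈-filter⁻; ∈-++⁻; ∈-map⁻; ∈-upTo⁻)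
  open import Data.List.Properties using (length-map; length-++; length-upTo; length-tabulate; map-id-local; map-∘)
  open import Data.List.Relation.Unary.All as All using ([])
  import Data.List.Relation.Unary.AllPairs as AllPairs
  open import Data.List.Relation.Unary.Any using (here)
  open import Data.List.Relation.Unary.Unique.Propositional using (Unique)
  import Data.List.Relation.Unary.Unique.Propositional.Properties as Unique
  open import Data.Nat.Base hiding (+-*-rawSemiring)
  open import Data.Nat.Divisibility using (divides)
  open import Data.Nat.DivMod using (m≡m%n+[m/n]*n; m%n<n; m<n⇒m%n≡m)
  open import Data.Nat.Primality using (Prime; prime⇒irreducible)
  open import Data.Nat.Properties
  open import Data.Nat.Tactic.RingSolver using (solve-∀)
  open import Data.Product.Base using (_×_; _,_; proj₁; proj₂; ∃-syntax; Σ-syntax)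
  open import Data.Rational.Base as ℚ using (ℚ; +-*-rawSemiring; toℚᵘ)
  import Data.Rational.Properties as ℚ
  import Data.Rational.Unnormalised.Base as ℚᵘ
  import Data.Rational.Unnormalised.Properties as ℚᵘ
  open import Algebra.Definitions.RawSemiring +-*-rawSemiring using () renaming (_^_ to _^ℚ_)
  open import Data.Sum.Base using (_⊎_; inj₁; inj₂)
  open import Data.Vec.Base using ([]; _∷_)
  open import Data.Vec.Properties using (∷-injective)
  open import Level using (0ℓ)
  open import Relation.Binary.Definitions using (tri<; tri≈; tri>)
  open import Relation.Binary.PropositionalEquality hiding ([_]; J)
  open import Relation.Nullary using (¬_; yes; no; contradiction)
  open import Relation.Nullary.Decidable using (¬?)
  open import Relation.Unary using (Decidable; Pred)
  open import Defs

  -- Congruences between natural numbers, and progressions in `𝔽 p` as congruences.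

  infix 4 _≡_[mod_]

  record _≡_[mod_] (a b p : ℕ) : Set where
    constructor mod-witness
    field
      k l : ℕ
      eq  : a + k * p ≡ b + l * p

  module _ {p : ℕ} where

    ≡⇒mod : ∀ {a b} → a ≡ b → a ≡ b [mod p ]
    ≡⇒mod eq = mod-witness 0 0 (cong (_+ 0) eq)

    mod-sym : ∀ {a b} → a ≡ b [mod p ] → b ≡ a [mod p ]
    mod-sym (mod-witness k l eq) = mod-witness l k (sym eq)

    mod-+ : ∀ {a b c d} → a ≡ b [mod p ] → c ≡ d [mod p ] → a + c ≡ b + d [mod p ]
    mod-+ {a} {b} {c} {d} (mod-witness k l eq) (mod-witness k′ l′ eq′) =
      mod-witness (k + k′) (l + l′)
        (trans (shuffle a c k k′ p) (trans (cong₂ _+_ eq eq′) (sym (shuffle b d l l′ p))))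
      where
      shuffle : ∀ a c k k′ p → a + c + (k + k′) * p ≡ (a + k * p) + (c + k′ * p)
      shuffle = solve-∀

    mod-trans : ∀ {a b c} → a ≡ b [mod p ] → b ≡ c [mod p ] → a ≡ c [mod p ]
    mod-trans {a} {b} {c} (mod-witness k l eq) (mod-witness k′ l′ eq′) =
      mod-witness (k + k′) (l′ + l)
        (trans (assoc a k k′ p) (trans (cong (_+ k′ * p) eq)
          (trans (swap b l k′ p) (trans (cong (_+ l * p) eq′) (sym (assoc c l′ l p))))))
      where
      assoc : ∀ a k k′ p → a + (k + k′) * p ≡ a + k * p + k′ * p
      assoc = solve-∀
      swap : ∀ b l k p → b + l * p + k * p ≡ b + k * p + l * p
      swap = solve-∀

    mod-*ʳ : ∀ {a b} c → a ≡ b [mod p ] → a * c ≡ b * c [mod p ]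
    mod-*ʳ {a} {b} c (mod-witness k l eq) = mod-witness (c * k) (c * l)
      (trans (dist a c k p) (trans (cong (_* c) eq) (sym (dist b c l p))))
      where
      dist : ∀ a c k p → a * c + (c * k) * p ≡ (a + k * p) * c
      dist = solve-∀

    mod-+-modulus : ∀ a → a + p ≡ a [mod p ]
    mod-+-modulus a = mod-witness 0 1 (lem a p)
      where
      lem : ∀ a p → a + p + 0 ≡ a + (p + 0)
      lem = solve-∀

    -- As `a < b`, the two sides can only balance if `l < k`; the surplus multiple of `p` on the
    -- left is the gap.
    mod-gap : ∀ {a b} → a ≡ b [mod p ] → a < b → a + p ≤ b
    mod-gap {a} {b} (mod-witness k l eq) a<b with ≤-<-connex k l
    ... | inj₁ k≤l = contradiction eq
      (<⇒≢ (+-mono-<-≤ a<b (*-monoˡ-≤ p k≤l)))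
    ... | inj₂ l<k = +-cancelʳ-≤ (l * p) (a + p) b (begin
      a + p + l * p   ≡⟨ +-assoc a p (l * p) ⟩
      a + suc l * p   ≤⟨ +-monoʳ-≤ a (*-monoˡ-≤ p l<k) ⟩
      a + k * p       ≡⟨ eq ⟩
      b + l * p       ∎)
      where open ≤-Reasoning

    mod-window : ∀ {a b} → a ≡ b [mod p ] → a < b + p → b < a + p → a ≡ b
    mod-window {a} {b} a≡b-mod a<b+p b<a+p with <-cmp a b
    ... | tri< a<b _ _ = contradiction (mod-gap a≡b-mod a<b) (<⇒≱ b<a+p)
    ... | tri≈ _ a≡b _ = a≡b
    ... | tri> _ _ b<a = contradiction (mod-gap (mod-sym a≡b-mod) b<a) (<⇒≱ a<b+p)

    -- The numbers `a + p` and `b` are congruent and less than `p` apart. This makes a wrapping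
    -- progression wrap exactly once.
    mod-next : ∀ {a b} → a ≡ b [mod p ] → a < b → b < 2 * p → a + p ≡ b
    mod-next {a} {b} a≡b-mod a<b b<2p =
      mod-window (mod-trans (mod-+-modulus a) a≡b-mod)
        (begin-strict a + p <⟨ +-monoˡ-< p a<b ⟩ b + p ∎)
        (begin-strict b <⟨ b<2p ⟩ 2 * p ≤⟨ m≤n+m (2 * p) a ⟩ a + 2 * p ≡⟨ lem a p ⟩ a + p + p ∎)
      where
      open ≤-Reasoning
      lem : ∀ a p → a + 2 * p ≡ a + p + p
      lem = solve-∀

  -- If the doubles differed, `mod-next` would make them differ by exactly the modulus, which is
  -- odd.
  mod-halve : ∀ {h a b} → 2 * a ≡ 2 * b [mod suc (2 * h) ] →
              a < suc (2 * h) → b < suc (2 * h) → a ≡ b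
  mod-halve {h} {a} {b} 2a≡2b-mod a<p b<p with <-cmp (2 * a) (2 * b)
  ... | tri< lt _ _ = contradiction (trans (sym (mod-next 2a≡2b-mod lt (*-monoʳ-< 2 b<p))) (lem a h))
                        (even≢odd b (a + h))
    where
    lem : ∀ a h → 2 * a + suc (2 * h) ≡ suc (2 * (a + h))
    lem = solve-∀
  ... | tri≈ _ eq _ = *-cancelˡ-≡ a b 2 eq
  ... | tri> _ _ gt = contradiction (trans (sym (mod-next (mod-sym 2a≡2b-mod) gt (*-monoʳ-< 2 a<p))) (lem b h))
                        (even≢odd a (b + h))
    where
    lem : ∀ a h → 2 * a + suc (2 * h) ≡ suc (2 * (a + h))
    lem = solve-∀

  module _ {p : ℕ} .{{_ : NonZero p}} where

    toℕ-fromℕₚ : ∀ k → toℕ (fromℕₚ {p} k) ≡ k [mod p ]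
    toℕ-fromℕₚ k = mod-witness (k / p) 0 (begin
      toℕ (fromℕₚ {p} k) + k / p * p  ≡⟨ cong (_+ k / p * p) (Fin.toℕ-fromℕ< _) ⟩
      k % p + k / p * p               ≡⟨ m≡m%n+[m/n]*n k p ⟨
      k                               ≡⟨ +-identityʳ k ⟨
      k + 0                           ∎)
      where open ≡-Reasoning

    toℕ-fromℕₚ-< : ∀ {k} → k < p → toℕ (fromℕₚ {p} k) ≡ k
    toℕ-fromℕₚ-< k<p = trans (Fin.toℕ-fromℕ< _) (m<n⇒m%n≡m k<p)

    -- Negation is the truncated difference `p ∸ u` with `u < p`. Adding `p` to `toℕ x + toℕ z` and
    -- writing it as `v + u` cancels that difference honestly.
    ap⇒mod : (x y z : 𝔽 p) → x +ₚ (-ₚ (fromℕₚ 2 *ₚ y)) +ₚ z ≡ fromℕₚ 0 →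
             toℕ x + toℕ z ≡ 2 * toℕ y [mod p ]
    ap⇒mod x y z eq = mod-trans (mod-sym (mod-+-modulus _)) (mod-trans (≡⇒mod split) (mod-trans step u≡2y))
      where
      u = toℕ (fromℕₚ {p} 2 *ₚ y)
      v = p ∸ u
      u≡2y : u ≡ 2 * toℕ y [mod p ]
      u≡2y = mod-trans (toℕ-fromℕₚ _) (mod-*ʳ (toℕ y) (toℕ-fromℕₚ 2))
      sum≡0 : toℕ x + v + toℕ z ≡ 0 [mod p ]
      sum≡0 = mod-trans
        (mod-sym (mod-trans (toℕ-fromℕₚ _)
          (mod-+ (mod-trans (toℕ-fromℕₚ _) (mod-+ (≡⇒mod refl) (toℕ-fromℕₚ v))) (≡⇒mod refl))))
        (mod-trans (≡⇒mod (cong toℕ eq)) (toℕ-fromℕₚ 0))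
      split : toℕ x + toℕ z + p ≡ toℕ x + v + toℕ z + u
      split = trans (cong (toℕ x + toℕ z +_) (sym (m∸n+n≡m (<⇒≤ (Fin.toℕ<n (fromℕₚ {p} 2 *ₚ y))))))
        (lem (toℕ x) (toℕ z) v u)
        where
        lem : ∀ x z v u → x + z + (v + u) ≡ x + v + z + u
        lem = solve-∀
      step : toℕ x + v + toℕ z + u ≡ u [mod p ]
      step = mod-+ sum≡0 (≡⇒mod refl)

  -- Strict midpoint convexity, for squares and for sums of weights.

  Midconvex : ∀ {X : Set} → (X → ℕ) → X → X → X → Set
  Midconvex f x y z = (x ≡ y × y ≡ z) ⊎ 2 * f y < f x + f z

  -- The parallelogram identity 2(x² + z²) = (x + z)² + (z - x)², with `a` for x and `a + d` for z.
  sum-of-squares-identity : ∀ a d → 2 * (a * a + (a + d) * (a + d)) ≡ (a + (a + d)) * (a + (a + d)) + d * d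
  sum-of-squares-identity = solve-∀

  square-midconvex′ : ∀ a d b → 2 * b ≤ a + (a + d) →
    (a ≡ b × b ≡ a + d) ⊎ 2 * (b * b) < a * a + (a + d) * (a + d)
  square-midconvex′ a zero b 2b≤ with m≤n⇒m<n∨m≡n b≤a
    where
    b≤a : b ≤ a
    b≤a = *-cancelˡ-≤ 2 (≤-trans 2b≤ (≤-reflexive (cong (a +_) refl)))
  ... | inj₁ b<a = inj₂ (begin-strict
      2 * (b * b)                       <⟨ *-monoʳ-< 2 (*-mono-< b<a b<a) ⟩
      2 * (a * a)                       ≡⟨ lem a ⟩
      a * a + (a + 0) * (a + 0)         ∎)
    where
    open ≤-Reasoning
    lem : ∀ a → 2 * (a * a) ≡ a * a + (a + 0) * (a + 0)
    lem = solve-∀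
  ... | inj₂ refl = inj₁ (refl , sym (+-identityʳ a))
  square-midconvex′ a (suc d) b 2b≤ = inj₂ (*-cancelˡ-< 2 _ _ (begin-strict
      2 * (2 * (b * b))                 ≡⟨ lem b ⟩
      2 * b * (2 * b)                   ≤⟨ *-mono-≤ 2b≤ 2b≤ ⟩
      s * s                             <⟨ m<m+n (s * s) z<s ⟩
      s * s + suc d * suc d             ≡⟨ sum-of-squares-identity a (suc d) ⟨
      2 * (a * a + (a + suc d) * (a + suc d)) ∎))
    where
    open ≤-Reasoning
    s = a + (a + suc d)
    lem : ∀ b → 2 * (2 * (b * b)) ≡ 2 * b * (2 * b)
    lem = solve-∀

  -- Squaring is increasing on natural numbers, so an inequality between `2 * b` and `a + c` is
  -- enough. It covers both genuine progressions and those with `a + c` equal to `2 * b + p`.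
  square-midconvex : ∀ a b c → 2 * b ≤ a + c → Midconvex (λ x → x * x) a b c
  square-midconvex a b c 2b≤a+c with ≤-total a c
  ... | inj₁ a≤c with k , refl ← m≤n⇒∃[o]m+o≡n a≤c = square-midconvex′ a k b 2b≤a+c
  ... | inj₂ c≤a with k , refl ← m≤n⇒∃[o]m+o≡n c≤a
        with square-midconvex′ c k b (≤-trans 2b≤a+c (≤-reflexive (+-comm (c + k) c)))
  ...   | inj₁ (c≡b , b≡a) = inj₁ (sym b≡a , sym c≡b)
  ...   | inj₂ lt = inj₂ (<-≤-trans lt (≤-reflexive (+-comm (c * c) _)))

  length-cartesianProductWith : ∀ {X Y Z : Set} (g : X → Y → Z) xs ys →
    length (cartesianProductWith g xs ys) ≡ length xs * length ys
  length-cartesianProductWith g []       ys = refl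
  length-cartesianProductWith g (x ∷ xs) ys = trans (length-++ (map (g x) ys))
    (cong₂ _+_ (length-map (g x) ys) (length-cartesianProductWith g xs ys))

  midconvex⇒≤ : ∀ {X : Set} {f : X → ℕ} {x y z} → Midconvex f x y z → 2 * f y ≤ f x + f z
  midconvex⇒≤ {f = f} {x} (inj₁ (refl , refl)) = ≤-reflexive (cong (f x +_) (+-identityʳ (f x)))
  midconvex⇒≤ (inj₂ lt) = <⇒≤ lt

  -- One strict summand makes the sum strict, the other contributing at least a weak inequality;
  -- only triples constant in both components escape. This is what carries convexity from one block
  -- to its powers.
  midconvex-+ : ∀ {X Y : Set} {f : X → ℕ} {g : Y → ℕ} {x y z u v w} →
    Midconvex f x y z → Midconvex g u v w →
    ((x ≡ y × y ≡ z) × (u ≡ v × v ≡ w)) ⊎ 2 * (f y + g v) < (f x + g u) + (f z + g w)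
  midconvex-+ {f = f} {g} {x} {y} {z} {u} {v} {w} mf mg = combine mf mg
    where
    open ≤-Reasoning
    interchange : ∀ a b c d → (a + c) + (b + d) ≡ (a + b) + (c + d)
    interchange = solve-∀
    sum< : 2 * f y + 2 * g v < (f x + f z) + (g u + g w) → 2 * (f y + g v) < (f x + g u) + (f z + g w)
    sum< lt = begin-strict
      2 * (f y + g v)               ≡⟨ *-distribˡ-+ 2 (f y) (g v) ⟩
      2 * f y + 2 * g v             <⟨ lt ⟩
      (f x + f z) + (g u + g w)     ≡⟨ interchange (f x) (g u) (f z) (g w) ⟩
      (f x + g u) + (f z + g w)     ∎
    combine : Midconvex f x y z → Midconvex g u v w → _
    combine (inj₁ eq) (inj₁ eq′) = inj₁ (eq , eq′)
    combine (inj₂ lt) _          = inj₂ (sum< (+-mono-<-≤ lt (midconvex⇒≤ {f = g} mg)))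
    combine (inj₁ _)  (inj₂ lt′) = inj₂ (sum< (+-mono-≤-< (midconvex⇒≤ {f = f} mf) lt′))

  -- Pigeonhole for level sets of a bounded function.

  module _ {X : Set} {P : Pred X 0ℓ} (P? : Decidable P) where

    length-filter-¬ : ∀ xs → length xs ≡ length (filter P? xs) + length (filter (λ x → ¬? (P? x)) xs)
    length-filter-¬ [] = refl
    length-filter-¬ (x ∷ xs) with P? x
    ... | yes _ = cong suc (length-filter-¬ xs)
    ... | no  _ = trans (cong suc (length-filter-¬ xs)) (sym (+-suc _ _))

  module _ {X : Set} (f : X → ℕ) where

    record LargeFibre (xs : List X) (T : ℕ) : Set where
      field
        value  : ℕ
        fibre  : List X
        unique : Unique xs → Unique fibre
        sound  : ∀ {x} → x ∈ fibre → x ∈ xs × f x ≡ value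
        large  : length xs ≤ length fibre * suc T

    -- Induction on `T`: the level set of `suc T` is split off, and the larger of it and the level
    -- set found in the rest is kept. If `L` bounds both sizes, then `xs` has at most
    -- `L + L * suc T` elements.
    pigeonhole : ∀ T xs → (∀ {x} → x ∈ xs → f x ≤ T) → LargeFibre xs T
    pigeonhole zero xs bounded = record
      { value  = 0
      ; fibre  = xs
      ; unique = λ u → u
      ; sound  = λ x∈ → x∈ , n≤0⇒n≡0 (bounded x∈)
      ; large  = ≤-reflexive (sym (*-identityʳ _))
      }
    pigeonhole (suc T) xs bounded = pick (≤-total (length top) (length fibre))
      where
      top? : Decidable (λ x → f x ≡ suc T)
      top? x = f x ≟ suc T
      top  = filter top? xs
      rest = filter (λ x → ¬? (top? x)) xs
      rest-bounded : ∀ {x} → x ∈ rest → f x ≤ T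
      rest-bounded x∈ = let x∈xs , fx≢ = ∈-filter⁻ (λ x → ¬? (top? x)) x∈ in
        s≤s⁻¹ (≤∧≢⇒< (bounded x∈xs) fx≢)
      open LargeFibre (pigeonhole T rest rest-bounded)
      open ≤-Reasoning
      size : ∀ L → length top ≤ L → length fibre ≤ L → length xs ≤ L * suc (suc T)
      size L top≤ fibre≤ = begin
        length xs                         ≡⟨ length-filter-¬ top? xs ⟩
        length top + length rest          ≤⟨ +-mono-≤ top≤ (≤-trans large (*-monoˡ-≤ (suc T) fibre≤)) ⟩
        L + L * suc T                     ≡⟨ *-suc L (suc T) ⟨
        L * suc (suc T)                   ∎
      pick : _ → LargeFibre xs (suc T)
      pick (inj₁ top≤) = record
        { value  = value
        ; fibre  = fibre
        ; unique = λ u → unique (Unique.filter⁺ (λ x → ¬? (top? x)) u)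
        ; sound  = λ x∈ → let x∈rest , eq = sound x∈ in proj₁ (∈-filter⁻ (λ x → ¬? (top? x)) x∈rest) , eq
        ; large  = size (length fibre) top≤ ≤-refl
        }
      pick (inj₂ fibre≤) = record
        { value  = suc T
        ; fibre  = top
        ; unique = Unique.filter⁺ top?
        ; sound  = ∈-filter⁻ top?
        ; large  = size (length top) ≤-refl fibre≤
        }

  -- Powers of a block and their progression-free level sets.

  module _ (p : ℕ) .{{_ : NonZero p}} where

    AP : 𝔽 p → 𝔽 p → 𝔽 p → Set
    AP x y z = x +ₚ (-ₚ (fromℕₚ 2 *ₚ y)) +ₚ z ≡ fromℕₚ 0

    record ConvexBlock : Set where
      field
        points : List (𝔽 p × 𝔽 p)
        unique : Unique points
        weight : 𝔽 p × 𝔽 p → ℕ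
        convex : ∀ {s t u} → s ∈ points → t ∈ points → u ∈ points →
                 AP (proj₁ s) (proj₁ t) (proj₁ u) → AP (proj₂ s) (proj₂ t) (proj₂ u) →
                 Midconvex weight s t u
        bound  : ℕ
        weight≤bound : ∀ {s} → s ∈ points → weight s ≤ bound

    module _ (block : ConvexBlock) where
      open ConvexBlock block

      prepend : ∀ {n} → 𝔽 p × 𝔽 p → 𝔽^ p n → 𝔽^ p (2 + n)
      prepend (a , b) v = a ∷ b ∷ v

      prepend-injective : ∀ {n s t} {u v : 𝔽^ p n} → prepend s u ≡ prepend t v → s ≡ t × u ≡ v
      prepend-injective refl = refl , refl

      power : ∀ n → List (𝔽^ p n)
      power 0             = [ [] ]
      -- In odd dimension the last coordinate is pinned to 0. The factor lost here is repaid by the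
      -- extra `a` in `^-≤-square-half`.
      power 1             = [ fromℕₚ 0 ∷ [] ]
      power (suc (suc n)) = cartesianProductWith prepend points (power n)

      powerWeight : ∀ {n} → 𝔽^ p n → ℕ
      powerWeight []          = 0
      powerWeight (_ ∷ [])    = 0
      powerWeight (a ∷ b ∷ v) = weight (a , b) + powerWeight v

      power-unique : ∀ n → Unique (power n)
      power-unique 0             = [] AllPairs.∷ AllPairs.[]
      power-unique 1             = [] AllPairs.∷ AllPairs.[]
      power-unique (suc (suc n)) =
        Unique.cartesianProductWith⁺ prepend prepend-injective unique (power-unique n)

      length-power : ∀ n → length (power n) ≡ length points ^ ⌊ n /2⌋
      length-power 0             = refl
      length-power 1             = refl
      length-power (suc (suc n)) = trans (length-cartesianProductWith prepend points (power n))
        (cong (length points *_) (length-power n))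

      powerWeight-≤ : ∀ n {v} → v ∈ power n → powerWeight v ≤ ⌊ n /2⌋ * bound
      powerWeight-≤ 0 (here refl) = z≤n
      powerWeight-≤ 1 (here refl) = z≤n
      powerWeight-≤ (suc (suc n)) v∈
        with _ , _ , s∈ , v′∈ , refl ← ∈-cartesianProductWith⁻ prepend points (power n) v∈ =
        +-mono-≤ (weight≤bound s∈) (powerWeight-≤ n v′∈)

      powerWeight-convex : ∀ n {u v w} → u ∈ power n → v ∈ power n → w ∈ power n →
                           u -ᵥ fromℕₚ 2 ·ᵥ v +ᵥ w ≡ 0ᵥ → Midconvex powerWeight u v w
      powerWeight-convex 0 (here refl) (here refl) (here refl) _ = inj₁ (refl , refl)
      powerWeight-convex 1 (here refl) (here refl) (here refl) _ = inj₁ (refl , refl)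
      powerWeight-convex (suc (suc n)) u∈ v∈ w∈ ap
        with s , u , s∈ , u′∈ , refl ← ∈-cartesianProductWith⁻ prepend points (power n) u∈
           | t , v , t∈ , v′∈ , refl ← ∈-cartesianProductWith⁻ prepend points (power n) v∈
           | r , w , r∈ , w′∈ , refl ← ∈-cartesianProductWith⁻ prepend points (power n) w∈
        with ap₁ , ap′ ← ∷-injective ap
        with ap₂ , ap₃ ← ∷-injective ap′
        with midconvex-+ {f = weight} {g = powerWeight} (convex s∈ t∈ r∈ ap₁ ap₂) (powerWeight-convex n u′∈ v′∈ w′∈ ap₃)
      ... | inj₁ ((refl , refl) , (refl , refl)) = inj₁ (refl , refl)
      ... | inj₂ lt = inj₂ lt

      -- On a level set of the weight the inequality of midpoint convexity is an equality.
      apFree-fibre : ∀ n {T} (lf : LargeFibre powerWeight (power n) T) →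
                     ThreeTermAPFree (LargeFibre.fibre lf)
      apFree-fibre n lf {x} x∈ y∈ z∈ (x≢y , _ , _ , ap)
        with x∈′ , refl ← LargeFibre.sound lf x∈ | y∈′ , fy ← LargeFibre.sound lf y∈ | z∈′ , fz ← LargeFibre.sound lf z∈
        with powerWeight-convex n x∈′ y∈′ z∈′ ap
      ... | inj₁ (x≡y , _) = x≢y x≡y
      ... | inj₂ lt = <-irrefl (trans (cong (2 *_) fy) (trans (2* (powerWeight x)) (cong (_ +_) (sym fz)))) lt
        where
        2* : ∀ a → 2 * a ≡ a + a
        2* = solve-∀

      record APFree (n : ℕ) : Set where
        field
          elements : List (𝔽^ p n)
          distinct : Unique elements
          apFree   : ThreeTermAPFree elements
          large    : length points ^ ⌊ n /2⌋ ≤ length elements * suc (⌊ n /2⌋ * bound)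

      lift : ∀ n → APFree n
      lift n = record
        { elements = fibre
        ; distinct = unique′ (power-unique n)
        ; apFree   = apFree-fibre n level
        ; large    = ≤-trans (≤-reflexive (sym (length-power n))) large
        }
        where
        level = pigeonhole powerWeight (⌊ n /2⌋ * bound) (power n) (powerWeight-≤ n)
        open LargeFibre level renaming (unique to unique′)

  -- Exponential growth against a linear factor.

  ⌊2n/2⌋≡n : ∀ n → ⌊ 2 * n /2⌋ ≡ n
  ⌊2n/2⌋≡n n = trans (cong (λ k → ⌊ n + k /2⌋) (+-identityʳ n)) (sym (n≡⌊n+n/2⌋ n))

  -- The inequality 1 + j/K ≤ (1 + 1/K)^j with denominators cleared. In the induction step the two
  -- sides differ by the slack `K ^ j * j`.
  bernoulli : ∀ K j → K ^ j * (K + j) ≤ suc K ^ j * K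
  bernoulli K zero    = ≤-reflexive (cong (_+ 0) (+-identityʳ K))
  bernoulli K (suc j) = begin
    K ^ suc j * (K + suc j)             ≤⟨ m≤m+n _ (K ^ j * j) ⟩
    K ^ suc j * (K + suc j) + K ^ j * j ≡⟨ lem K (K ^ j) j ⟩
    suc K * (K ^ j * (K + j))           ≤⟨ *-monoʳ-≤ (suc K) (bernoulli K j) ⟩
    suc K * (suc K ^ j * K)             ≡⟨ *-assoc (suc K) (suc K ^ j) K ⟨
    suc K ^ suc j * K                   ∎
    where
    open ≤-Reasoning
    lem : ∀ K x j → K * x * (K + suc j) + x * j ≡ suc K * (x * (K + j))
    lem = solve-∀

  -- Bernoulli's inequality for the two halves of the exponent gives quadratic growth.
  exponential-beats-linear : ∀ K .{{_ : NonZero K}} a B →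
    ∃[ m₀ ] ∀ m → m ≥ m₀ → K ^ m * (a * suc (m * B)) ≤ suc K ^ m
  exponential-beats-linear K a B = 2 * suc J , λ m m≥ → *-cancelʳ-≤ _ _ (K * K) {{m*n≢0 K K}} (bound m m≥)
    where
    -- For `k ≤ suc j` and `j ≥ 1` the linear factor `suc ((j + k) * B)` is at most
    -- `j * suc (3 * B)`. Each of the two uses of Bernoulli costs a factor `K`, so `J < j ≤ k` lets
    -- `j * k` dominate everything.
    J = K * K * (a * suc (3 * B))
    open ≤-Reasoning
    halves : ∀ j k → j ≤ k → k ≤ suc j → suc J ≤ j →
             K ^ (j + k) * (a * suc ((j + k) * B)) * (K * K) ≤ suc K ^ (j + k) * (K * K)
    halves j@(suc _) k j≤k k≤1+j J<j = begin
      K ^ (j + k) * (a * suc ((j + k) * B)) * (K * K)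
        ≡⟨ *-assoc (K ^ (j + k)) _ _ ⟩
      K ^ (j + k) * (a * suc ((j + k) * B) * (K * K))
        ≤⟨ *-monoʳ-≤ (K ^ (j + k)) quadratic ⟩
      K ^ (j + k) * (j * k)
        ≡⟨ cong (_* (j * k)) (^-distribˡ-+-* K j k) ⟩
      K ^ j * K ^ k * (j * k)
        ≡⟨ swap (K ^ j) (K ^ k) j k ⟩
      (K ^ j * j) * (K ^ k * k)
        ≤⟨ *-mono-≤ (weak j) (weak k) ⟩
      (suc K ^ j * K) * (suc K ^ k * K)
        ≡⟨ swap (suc K ^ j) (suc K ^ k) K K ⟨
      suc K ^ j * suc K ^ k * (K * K)
        ≡⟨ cong (_* (K * K)) (^-distribˡ-+-* (suc K) j k) ⟨
      suc K ^ (j + k) * (K * K) ∎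
      where
      swap : ∀ x y j k → x * y * (j * k) ≡ (x * j) * (y * k)
      swap = solve-∀
      weak : ∀ j → K ^ j * j ≤ suc K ^ j * K
      weak j = ≤-trans (*-monoʳ-≤ (K ^ j) (m≤n+m j K)) (bernoulli K j)
      regroup : ∀ a b j K → a * (j * b) * (K * K) ≡ K * K * (a * b) * j
      regroup = solve-∀
      linear : suc ((j + k) * B) ≤ j * suc (3 * B)
      linear = begin
        suc ((j + k) * B)          ≤⟨ +-mono-≤ (s≤s (z≤n {pred j})) (*-monoˡ-≤ B (+-monoʳ-≤ j k≤1+j)) ⟩
        j + (j + suc j) * B        ≤⟨ +-monoʳ-≤ j (*-monoˡ-≤ B (+-monoʳ-≤ j (+-monoˡ-≤ j (s≤s (z≤n {pred j}))))) ⟩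
        j + (j + (j + j)) * B      ≡⟨ lem j B ⟩
        j * suc (3 * B)            ∎
        where
        lem : ∀ j B → j + (j + (j + j)) * B ≡ j * suc (3 * B)
        lem = solve-∀
      quadratic : a * suc ((j + k) * B) * (K * K) ≤ j * k
      quadratic = begin
        a * suc ((j + k) * B) * (K * K)  ≤⟨ *-monoˡ-≤ (K * K) (*-monoʳ-≤ a linear) ⟩
        a * (j * suc (3 * B)) * (K * K)  ≡⟨ regroup a (suc (3 * B)) j K ⟩
        J * j                            ≤⟨ *-mono-≤ (<⇒≤ J<j) j≤k ⟩
        j * k                            ∎
    bound : ∀ m → m ≥ 2 * suc J → K ^ m * (a * suc (m * B)) * (K * K) ≤ suc K ^ m * (K * K)
    bound m m≥ = subst (λ m → K ^ m * (a * suc (m * B)) * (K * K) ≤ suc K ^ m * (K * K))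
      (⌊n/2⌋+⌈n/2⌉≡n m)
      (halves ⌊ m /2⌋ ⌈ m /2⌉ (⌊n/2⌋≤⌈n/2⌉ m) (⌊n/2⌋-mono (n≤1+n (suc m)))
        (subst (_≤ ⌊ m /2⌋) (⌊2n/2⌋≡n (suc J)) (⌊n/2⌋-mono m≥)))

  -- Blocks of pairs of natural numbers and convexity of their weight.

  -- Both kinds of column admit no progression that wraps around modulo 2h + 1 (for
  -- even numbers because 2 is invertible), so squares are convex on them.
  data Shape (h : ℕ) : ℕ × ℕ → Set where
    left  : ∀ {i w} → i ≤ h → w ≤ h → Shape h (i , 2 * w)
    right : ∀ {i y} → h < i → i < suc (2 * h) → h < y → y < suc (2 * h) → Shape h (i , y)

  record NatBlock (h : ℕ) : Set where
    field
      points   : List (ℕ × ℕ)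
      unique   : Unique points
      shape    : ∀ {s} → s ∈ points → Shape h s
      noWrap   : ∀ {i₁ y₁ i₂ y₂ i₃ y₃} →
                 (i₁ , y₁) ∈ points → (i₂ , y₂) ∈ points → (i₃ , y₃) ∈ points →
                 i₁ + i₃ + suc (2 * h) ≡ 2 * i₂ → ¬ (y₁ + y₃ ≡ 2 * y₂ [mod suc (2 * h) ])

  module _ {h : ℕ} where

    private
      p : ℕ
      p = suc (2 * h)

      h<p : h < p
      h<p = s≤s (m≤m+n h (h + 0))

      w≤h⇒2w<p : ∀ {w} → w ≤ h → 2 * w < p
      w≤h⇒2w<p w≤h = s≤s (*-monoʳ-≤ 2 w≤h)

      sum<p : ∀ {w w′} → w ≤ h → w′ ≤ h → w + w′ < p
      sum<p {w} {w′} w≤h w′≤h = s≤s (≤-trans (+-mono-≤ w≤h w′≤h) (≤-reflexive (cong (h +_) (sym (+-identityʳ h)))))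

    shape-bounds : ∀ {s} → Shape h s → proj₁ s < p × proj₂ s < p
    shape-bounds (left i≤h w≤h)      = ≤-<-trans i≤h h<p , w≤h⇒2w<p w≤h
    shape-bounds (right _ i<p _ y<p) = i<p , y<p

    -- Two is invertible modulo `p`, and `w₁ + w₃ ≤ 2 * h < p`, so the halved congruence is an
    -- equality.
    halved-ap : ∀ {w₁ w₃ y} → w₁ ≤ h → w₃ ≤ h → y < p →
                2 * w₁ + 2 * w₃ ≡ 2 * y [mod p ] → w₁ + w₃ ≡ y
    halved-ap {w₁} {w₃} w₁≤h w₃≤h y<p ap =
      mod-halve {h} (mod-trans (≡⇒mod (*-distribˡ-+ 2 w₁ w₃)) ap) (sum<p w₁≤h w₃≤h) y<p

    -- On the left, `halved-ap` applies. On the right all entries lie strictly between `h` and `p`,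
    -- so the two sums lie less than `p` apart.
    column-ap : ∀ {i y₁ y₂ y₃} → Shape h (i , y₁) → Shape h (i , y₂) → Shape h (i , y₃) →
                y₁ + y₃ ≡ 2 * y₂ [mod p ] → 2 * y₂ ≡ y₁ + y₃
    column-ap (left {w = w₁} _ w₁≤h) (left _ w₂≤h) (left {w = w₃} _ w₃≤h) ap =
      trans (cong (2 *_) (sym (halved-ap w₁≤h w₃≤h (w≤h⇒2w<p w₂≤h) ap))) (*-distribˡ-+ 2 w₁ w₃)
    column-ap {y₁ = y₁} {y₂} {y₃} (right _ _ h<y₁ y₁<p) (right _ _ h<y₂ y₂<p) (right _ _ h<y₃ y₃<p) ap =
      trans 2y₂≡y₂+y₂ (sym (mod-window (mod-trans ap (≡⇒mod 2y₂≡y₂+y₂))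
        (near y₁<p y₃<p h<y₂ h<y₂) (near y₂<p y₂<p h<y₁ h<y₃)))
      where
      2y₂≡y₂+y₂ : 2 * y₂ ≡ y₂ + y₂
      2y₂≡y₂+y₂ = cong (y₂ +_) (+-identityʳ y₂)
      near : ∀ {a b c d} → a < p → b < p → h < c → h < d → a + b < c + d + p
      near a<p b<p h<c h<d = +-mono-≤-<
        (≤-trans (s≤s⁻¹ a<p) (+-mono-≤ (<⇒≤ h<c) (≤-trans (≤-reflexive (+-identityʳ h)) (<⇒≤ h<d)))) b<p
    column-ap (left i≤h _) (right h<i _ _ _) _ _ = contradiction i≤h (<⇒≱ h<i)
    column-ap (left i≤h _) _ (right h<i _ _ _) _ = contradiction i≤h (<⇒≱ h<i)
    column-ap (right h<i _ _ _) (left i≤h _) _ _ = contradiction i≤h (<⇒≱ h<i)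
    column-ap (right h<i _ _ _) _ (left i≤h _) _ = contradiction i≤h (<⇒≱ h<i)

    -- The factor 2p² exceeds 2y² for every y < p, so a strict inequality between the squares of the
    -- first coordinates outweighs whatever the second coordinates do.
    natWeight : ℕ × ℕ → ℕ
    natWeight (i , y) = 2 * (p * p) * (i * i) + y * y

    module _ (block : NatBlock h) where
      open NatBlock block

      -- The weight is dominated by i²; its y² part only matters within a column.
      block-convex : ∀ {i₁ y₁ i₂ y₂ i₃ y₃} → (i₁ , y₁) ∈ points → (i₂ , y₂) ∈ points → (i₃ , y₃) ∈ points →
        i₁ + i₃ ≡ 2 * i₂ [mod p ] → y₁ + y₃ ≡ 2 * y₂ [mod p ] →
        Midconvex natWeight (i₁ , y₁) (i₂ , y₂) (i₃ , y₃)
      block-convex {i₁} {y₁} {i₂} {y₂} {i₃} {y₃} ∈₁ ∈₂ ∈₃ iAP yAP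
        with ≤-<-connex (2 * i₂) (i₁ + i₃)
      -- As `2 * i₂ < 2 * p`, a congruent sum below `2 * i₂` falls short by exactly `p`.
      ... | inj₂ wraps = contradiction yAP (noWrap ∈₁ ∈₂ ∈₃
              (mod-next iAP wraps (*-monoʳ-< 2 (proj₁ (shape-bounds (shape ∈₂))))))
      ... | inj₁ 2i₂≤ with square-midconvex i₁ i₂ i₃ 2i₂≤
      ...   | inj₁ (refl , refl) = column (square-midconvex y₁ y₂ y₃
                (≤-reflexive (column-ap (shape ∈₁) (shape ∈₂) (shape ∈₃) yAP)))
        where
        open ≤-Reasoning
        i² = 2 * (p * p) * (i₁ * i₁)
        split : ∀ c y → 2 * (c + y) ≡ c + c + 2 * y
        split = solve-∀
        regroup : ∀ c y y′ → c + c + (y + y′) ≡ c + y + (c + y′)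
        regroup = solve-∀
        column : Midconvex (λ y → y * y) y₁ y₂ y₃ → Midconvex natWeight (i₁ , y₁) (i₁ , y₂) (i₁ , y₃)
        column (inj₁ (refl , refl)) = inj₁ (refl , refl)
        column (inj₂ lt)            = inj₂ (begin-strict
          2 * (i² + y₂ * y₂)                   ≡⟨ split i² (y₂ * y₂) ⟩
          i² + i² + 2 * (y₂ * y₂)              <⟨ +-monoʳ-< (i² + i²) lt ⟩
          i² + i² + (y₁ * y₁ + y₃ * y₃)        ≡⟨ regroup i² (y₁ * y₁) (y₃ * y₃) ⟩
          i² + y₁ * y₁ + (i² + y₃ * y₃)        ∎)
      ...   | inj₂ lt = inj₂ (begin-strict
          2 * (M * (i₂ * i₂) + y₂ * y₂)        ≡⟨ split M (i₂ * i₂) (y₂ * y₂) ⟩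
          M * (2 * (i₂ * i₂)) + 2 * (y₂ * y₂)  <⟨ +-monoʳ-< _ (*-monoʳ-< 2 (*-mono-< y₂<p y₂<p)) ⟩
          M * (2 * (i₂ * i₂)) + M              ≡⟨ trans (+-comm _ M) (sym (*-suc M _)) ⟩
          M * suc (2 * (i₂ * i₂))              ≤⟨ *-monoʳ-≤ M lt ⟩
          M * (i₁ * i₁ + i₃ * i₃)              ≤⟨ m≤m+n _ (y₁ * y₁ + y₃ * y₃) ⟩
          M * (i₁ * i₁ + i₃ * i₃) + (y₁ * y₁ + y₃ * y₃) ≡⟨ regroup M (i₁ * i₁) (i₃ * i₃) (y₁ * y₁) (y₃ * y₃) ⟩
          M * (i₁ * i₁) + y₁ * y₁ + (M * (i₃ * i₃) + y₃ * y₃) ∎)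
        where
        open ≤-Reasoning
        M = 2 * (p * p)
        y₂<p : y₂ < p
        y₂<p = proj₂ (shape-bounds (shape ∈₂))
        split : ∀ M i y → 2 * (M * i + y) ≡ M * (2 * i) + 2 * y
        split = solve-∀
        regroup : ∀ M i i′ y y′ → M * (i + i′) + (y + y′) ≡ M * i + y + (M * i′ + y′)
        regroup = solve-∀

    toℕ² : 𝔽 p × 𝔽 p → ℕ × ℕ
    toℕ² (a , b) = toℕ a , toℕ b

    fromℕ² : ℕ × ℕ → 𝔽 p × 𝔽 p
    fromℕ² (i , y) = fromℕₚ i , fromℕₚ y

    toℕ²-injective : ∀ {s t} → toℕ² s ≡ toℕ² t → s ≡ t
    toℕ²-injective eq = cong₂ _,_ (Fin.toℕ-injective (cong proj₁ eq)) (Fin.toℕ-injective (cong proj₂ eq))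

    convexBlock : NatBlock h → ConvexBlock p
    convexBlock block = record
      { points = map fromℕ² points
      -- Reduction modulo `p` is not injective on all pairs, so distinctness is pulled back along
      -- `toℕ²`, which undoes it on the points of the block.
      ; unique = Unique.map⁻ {f = toℕ²} (subst Unique (sym to∘from-points) unique)
      ; weight = λ s → natWeight (toℕ² s)
      ; convex = λ {s} {t} {u} s∈ t∈ u∈ ap₁ ap₂ → reflect
          (block-convex block (lower s∈) (lower t∈) (lower u∈) (ap⇒mod (proj₁ s) (proj₁ t) (proj₁ u) ap₁)
           (ap⇒mod (proj₂ s) (proj₂ t) (proj₂ u) ap₂))
      ; bound  = natWeight (p , p)
      ; weight≤bound = λ {s} _ → +-mono-≤ (*-monoʳ-≤ (2 * (p * p)) (square (proj₁ s))) (square (proj₂ s))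
      }
      where
      open NatBlock block
      to∘from : ∀ {s} → s ∈ points → toℕ² (fromℕ² s) ≡ s
      to∘from s∈ = let i<p , y<p = shape-bounds (shape s∈) in
        cong₂ _,_ (toℕ-fromℕₚ-< i<p) (toℕ-fromℕₚ-< y<p)
      to∘from-points : map toℕ² (map fromℕ² points) ≡ points
      to∘from-points = trans (sym (map-∘ points)) (map-id-local (All.tabulate to∘from))
      lower : ∀ {s} → s ∈ map fromℕ² points → toℕ² s ∈ points
      lower s∈ with s , s∈′ , refl ← ∈-map⁻ fromℕ² s∈ = subst (_∈ points) (sym (to∘from s∈′)) s∈′
      reflect : ∀ {s t u} → Midconvex natWeight (toℕ² s) (toℕ² t) (toℕ² u) →
                Midconvex (λ s → natWeight (toℕ² s)) s t u
      reflect (inj₁ (eq , eq′)) = inj₁ (toℕ²-injective eq , toℕ²-injective eq′)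
      reflect (inj₂ lt)         = inj₂ lt
      square : (a : 𝔽 p) → toℕ a * toℕ a ≤ p * p
      square a = *-mono-≤ (<⇒≤ (Fin.toℕ<n a)) (<⇒≤ (Fin.toℕ<n a))

  -- Boxes of points, and the square block for small primes.

  box : (ℕ → ℕ) → (ℕ → ℕ) → ℕ → ℕ → List (ℕ × ℕ)
  box f g n m = cartesianProductWith (λ i w → f i , g w) (upTo n) (upTo m)

  length-box : ∀ f g n m → length (box f g n m) ≡ n * m
  length-box f g n m = trans (length-cartesianProductWith _ (upTo n) (upTo m))
    (cong₂ _*_ (length-upTo n) (length-upTo m))

  unique-box : ∀ {f g} n m → (∀ {i j} → f i ≡ f j → i ≡ j) → (∀ {i j} → g i ≡ g j → i ≡ j) →
               Unique (box f g n m)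
  unique-box n m f-inj g-inj = Unique.cartesianProductWith⁺ _
    (λ eq → f-inj (cong proj₁ eq) , g-inj (cong proj₂ eq)) (Unique.upTo⁺ n) (Unique.upTo⁺ m)

  ∈-box : ∀ f g n m {s} → s ∈ box f g n m →
          ∃[ i ] ∃[ w ] i < n × w < m × s ≡ (f i , g w)
  ∈-box f g n m s∈ with i , w , i∈ , w∈ , eq ← ∈-cartesianProductWith⁻ _ (upTo n) (upTo m) s∈ =
    i , w , ∈-upTo⁻ i∈ , ∈-upTo⁻ w∈ , eq

  -- Every column is at most `h`, so twice the middle column is below `p` and nothing can wrap.
  smallBlock : ∀ h → NatBlock h
  smallBlock h = record
    { points = box (λ i → i) (2 *_) (suc h) (suc h)
    ; unique = unique-box (suc h) (suc h) (λ eq → eq) (*-cancelˡ-≡ _ _ 2)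
    ; shape  = λ s∈ → shape′ (∈-box _ _ (suc h) (suc h) s∈)
    ; noWrap = λ {i₁} {_} {_} {_} {i₃} _ t∈ _ eq _ → contradiction (m≤n+m (suc (2 * h)) (i₁ + i₃))
        (<⇒≱ (≤-<-trans (≤-reflexive eq) (s≤s (*-monoʳ-≤ 2 (column≤h (∈-box _ _ (suc h) (suc h) t∈))))))
    }
    where
    shape′ : ∀ {s} → ∃[ i ] ∃[ w ] i < suc h × w < suc h × s ≡ (i , 2 * w) → Shape h s
    shape′ (_ , _ , i<1+h , w<1+h , refl) = left (s≤s⁻¹ i<1+h) (s≤s⁻¹ w<1+h)
    column≤h : ∀ {i y} → ∃[ i′ ] ∃[ w ] i′ < suc h × w < suc h × (i , y) ≡ (i′ , 2 * w) → i ≤ h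
    column≤h (_ , _ , i<1+h , _ , refl) = s≤s⁻¹ i<1+h

  unique-++-separated : ∀ {Y : Set} k {xs ys : List (ℕ × Y)} →
    (∀ {s} → s ∈ xs → proj₁ s < k) → (∀ {s} → s ∈ ys → k ≤ proj₁ s) →
    Unique xs → Unique ys → Unique (xs ++ ys)
  unique-++-separated k below above xs! ys! =
    Unique.++⁺ xs! ys! λ (∈xs , ∈ys) → <⇒≱ (below ∈xs) (above ∈ys)

  -- The four-box block for large primes.

  module _ (q h : ℕ) (4q≤h : 4 * q ≤ h) where

    private
      p : ℕ
      p = suc (2 * h)

    -- A wrapping progression has its middle column at suc h + e with i₁ + i₃ = 1 + 2e.
    -- Halving the second coordinates gives w₁ + w₃ = y₂, but w₁ + w₃ < 4q if e < q and
    -- w₁ + w₃ < 6q if e < 2q. For q ≈ p / 8 the density 18 q² / p² is about 9 / 32.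
    data Large : ℕ × ℕ → Set where
      low  : ∀ {i w} → i < 2 * q → w < 2 * q → Large (i , 2 * w)
      mid  : ∀ {i w} → i < 2 * q → w < 4 * q → Large (2 * q + i , 2 * w)
      high : ∀ {d v} → d < q → v < 4 * q → Large (suc h + d , suc h + v)
      top  : ∀ {d v} → d < q → v < 2 * q → Large (suc h + q + d , suc h + 2 * q + v)

    private
      2q≤4q : 2 * q ≤ 4 * q
      2q≤4q = *-monoˡ-≤ q (s≤s (s≤s (z≤n {2})))

      q≤2q : q ≤ 2 * q
      q≤2q = m≤m+n q (q + 0)

      2q+2q : 2 * q + 2 * q ≡ 4 * q
      2q+2q = sym (*-distribʳ-+ q 2 2)

      2q≤h : 2 * q ≤ h
      2q≤h = ≤-trans 2q≤4q 4q≤h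

      <4q⇒≤h : ∀ {k} → k < 4 * q → k ≤ h
      <4q⇒≤h k<4q = ≤-trans (<⇒≤ k<4q) 4q≤h

      2q+<4q : ∀ {i} → i < 2 * q → 2 * q + i < 4 * q
      2q+<4q i<2q = <-≤-trans (+-monoʳ-< (2 * q) i<2q) (≤-reflexive 2q+2q)

      beyond-h<p : ∀ {k} → k < h → suc h + k < p
      beyond-h<p k<h = <-≤-trans (+-monoʳ-< (suc h) k<h) (≤-reflexive (cong (λ k → suc (h + k)) (sym (+-identityʳ h))))

      beyond-h+<p : ∀ {c k} → c + k < h → suc h + c + k < p
      beyond-h+<p {c} {k} lt = ≤-<-trans (≤-reflexive (+-assoc (suc h) c k)) (beyond-h<p lt)

      h<beyond+ : ∀ c k → h < suc h + c + k
      h<beyond+ c k = ≤-trans (m≤m+n (suc h) c) (m≤m+n (suc h + c) k)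

      q+<h : ∀ {d} → d < q → q + d < h
      q+<h d<q = <-≤-trans (+-monoʳ-< q d<q) (≤-trans (≤-reflexive (cong (q +_) (sym (+-identityʳ q)))) 2q≤h)

    large-shape : ∀ {s} → Large s → Shape h s
    large-shape (low i< w<)  = left (<4q⇒≤h (<-≤-trans i< 2q≤4q)) (<4q⇒≤h (<-≤-trans w< 2q≤4q))
    large-shape (mid i< w<)  = left (<4q⇒≤h (2q+<4q i<)) (<4q⇒≤h w<)
    large-shape (high {d} {v} d< v<) = right (m≤m+n (suc h) d) (beyond-h<p (<-≤-trans d< (≤-trans q≤2q 2q≤h)))
      (m≤m+n (suc h) v) (beyond-h<p (<-≤-trans v< 4q≤h))
    large-shape (top {d} {v} d< v<)  = right (h<beyond+ q d) (beyond-h+<p (q+<h d<))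
      (h<beyond+ (2 * q) v) (beyond-h+<p (<-≤-trans (2q+<4q v<) 4q≤h))

    narrow-column : ∀ {i y} → Large (i , y) → i < 2 * q → ∃[ w ] w < 2 * q × y ≡ 2 * w
    narrow-column (low _ w<)       _    = _ , w< , refl
    narrow-column (mid {i} _ _)    i<2q = contradiction (m≤m+n (2 * q) i) (<⇒≱ i<2q)
    narrow-column (high {d} _ _)   i<2q = contradiction (≤-trans 2q≤h (≤-trans (n≤1+n h) (m≤m+n (suc h) d))) (<⇒≱ i<2q)
    narrow-column (top {d} _ _)    i<2q = contradiction (≤-trans 2q≤h (<⇒≤ (h<beyond+ q d))) (<⇒≱ i<2q)

    wide-column : ∀ {i y} → Large (i , y) → i < 4 * q → ∃[ w ] w < 4 * q × y ≡ 2 * w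
    wide-column (low _ w<)       _    = _ , <-≤-trans w< 2q≤4q , refl
    wide-column (mid _ w<)       _    = _ , w< , refl
    wide-column (high {d} _ _)   i<4q = contradiction (≤-trans 4q≤h (≤-trans (n≤1+n h) (m≤m+n (suc h) d))) (<⇒≱ i<4q)
    wide-column (top {d} _ _)    i<4q = contradiction (≤-trans 4q≤h (<⇒≤ (h<beyond+ q d))) (<⇒≱ i<4q)

    left-never-wraps : ∀ {e i} → i < 4 * q → e + p ≢ 2 * i
    left-never-wraps {e} i<4q eq = <⇒≱
      (≤-<-trans (≤-reflexive eq) (s≤s (*-monoʳ-≤ 2 (<4q⇒≤h i<4q)))) (m≤n+m p e)

    wrapped-sum : ∀ {e} k → e + p ≡ 2 * (suc h + k) → e ≡ suc (2 * k)
    wrapped-sum {e} k eq = +-cancelʳ-≡ p e (suc (2 * k)) (trans eq (lem h k))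
      where
      lem : ∀ h k → 2 * (suc h + k) ≡ suc (2 * k) + suc (2 * h)
      lem = solve-∀

    suc-double< : ∀ {k m} → k < m → suc (2 * k) < 2 * m
    suc-double< {k} {m} k<m = <-≤-trans (n<1+n _) (≤-trans (≤-reflexive (lem k)) (*-monoʳ-≤ 2 k<m))
      where
      lem : ∀ k → suc (suc (2 * k)) ≡ 2 * suc k
      lem = solve-∀

    -- Both outer columns lie below `2 * q`, so `w₁ + w₃ < 4 * q ≤ h`, whereas the middle entry
    -- exceeds `h`.
    high-noWrap : ∀ {i₁ y₁ v i₃ y₃} → Large (i₁ , y₁) → Large (i₃ , y₃) → v < 4 * q →
                  i₁ + i₃ < 2 * q → ¬ (y₁ + y₃ ≡ 2 * (suc h + v) [mod p ])
    high-noWrap {i₁} {_} {v} {i₃} L₁ L₃ v< sum< ap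
      with w₁ , w₁< , refl ← narrow-column L₁ (≤-<-trans (m≤m+n i₁ i₃) sum<)
         | w₃ , w₃< , refl ← narrow-column L₃ (≤-<-trans (m≤n+m i₃ i₁) sum<) =
      <⇒≢ w₁+w₃< (halved-ap {h} (<4q⇒≤h (<-≤-trans w₁< 2q≤4q)) (<4q⇒≤h (<-≤-trans w₃< 2q≤4q))
        (beyond-h<p (<-≤-trans v< 4q≤h)) ap)
      where
      open ≤-Reasoning
      w₁+w₃< : w₁ + w₃ < suc h + v
      w₁+w₃< = begin-strict
        w₁ + w₃          <⟨ +-mono-< w₁< w₃< ⟩
        2 * q + 2 * q    ≡⟨ 2q+2q ⟩
        4 * q            ≤⟨ 4q≤h ⟩
        h                ≤⟨ m≤n+m h 1 ⟩
        suc h            ≤⟨ m≤m+n (suc h) v ⟩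
        suc h + v        ∎

    -- Two columns with sum below `4 * q` cannot both reach `2 * q`, so at least one is short. Hence
    -- `w₁ + w₃ < 2 * q + 4 * q ≤ 2 * q + h`, whereas the middle entry is at least `suc h + 2 * q`.
    top-noWrap : ∀ {i₁ y₁ v i₃ y₃} → Large (i₁ , y₁) → Large (i₃ , y₃) → v < 2 * q →
                 i₁ + i₃ < 4 * q → ¬ (y₁ + y₃ ≡ 2 * (suc h + 2 * q + v) [mod p ])
    top-noWrap {i₁} {_} {v} {i₃} L₁ L₃ v< sum< ap
      with w₁ , w₁< , refl ← wide-column L₁ (≤-<-trans (m≤m+n i₁ i₃) sum<)
         | w₃ , w₃< , refl ← wide-column L₃ (≤-<-trans (m≤n+m i₃ i₁) sum<) =
      <⇒≢ w₁+w₃< (halved-ap {h} (<4q⇒≤h w₁<) (<4q⇒≤h w₃<) (beyond-h+<p (<-≤-trans (2q+<4q v<) 4q≤h)) ap)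
      where
      bound : ∀ {w w′} → w < 2 * q → w′ < 4 * q → w + w′ < suc h + 2 * q + v
      bound {w} {w′} w< w′< = begin-strict
        w + w′               <⟨ +-mono-< w< w′< ⟩
        2 * q + 4 * q        ≤⟨ +-monoʳ-≤ (2 * q) (≤-trans 4q≤h (n≤1+n h)) ⟩
        2 * q + suc h        ≡⟨ +-comm (2 * q) (suc h) ⟩
        suc h + 2 * q        ≤⟨ m≤m+n _ v ⟩
        suc h + 2 * q + v    ∎
        where open ≤-Reasoning
      narrow : ∀ {i w} → Large (i , 2 * w) → i < 2 * q → w < 2 * q
      narrow {_} {w} L i< = let w′ , w′< , eq = narrow-column L i< in
        subst (_< 2 * q) (*-cancelˡ-≡ w′ w 2 (sym eq)) w′<
      w₁+w₃< : w₁ + w₃ < suc h + 2 * q + v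
      w₁+w₃< with <-≤-connex i₁ (2 * q)
      ... | inj₁ i₁<2q = bound (narrow L₁ i₁<2q) w₃<
      ... | inj₂ 2q≤i₁ = ≤-<-trans (≤-reflexive (+-comm w₁ w₃)) (bound (narrow L₃ i₃<2q) w₁<)
        where
        i₃<2q : i₃ < 2 * q
        i₃<2q = +-cancelˡ-< (2 * q) i₃ (2 * q)
          (<-≤-trans (≤-<-trans (+-monoˡ-≤ i₃ 2q≤i₁) sum<) (≤-reflexive (sym 2q+2q)))

    large-noWrap : ∀ {i₁ y₁ i₂ y₂ i₃ y₃} → Large (i₁ , y₁) → Large (i₂ , y₂) → Large (i₃ , y₃) →
                   i₁ + i₃ + p ≡ 2 * i₂ → ¬ (y₁ + y₃ ≡ 2 * y₂ [mod p ])
    large-noWrap _ (low i< _) _ eq _ = left-never-wraps (<-≤-trans i< 2q≤4q) eq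
    large-noWrap _ (mid i< _) _ eq _ = left-never-wraps (2q+<4q i<) eq
    large-noWrap {i₁} {i₃ = i₃} L₁ (high {d} d< v<) L₃ eq =
      high-noWrap L₁ L₃ v< (≤-<-trans (≤-reflexive (wrapped-sum d eq)) (suc-double< d<))
    large-noWrap {i₁} {i₃ = i₃} L₁ (top {d} d< v<) L₃ eq =
      top-noWrap L₁ L₃ v< (begin-strict
        i₁ + i₃          ≡⟨ wrapped-sum (q + d) (trans eq (cong (2 *_) (+-assoc (suc h) q d))) ⟩
        suc (2 * (q + d)) <⟨ suc-double< (+-monoʳ-< q d<) ⟩
        2 * (q + q)      ≡⟨ lem q ⟩
        4 * q            ∎)
      where
      open ≤-Reasoning
      lem : ∀ q → 2 * (q + q) ≡ 4 * q
      lem = solve-∀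

    lowBox midBox highBox topBox largePoints : List (ℕ × ℕ)
    lowBox  = box (λ i → i) (2 *_) (2 * q) (2 * q)
    midBox  = box (2 * q +_) (2 *_) (2 * q) (4 * q)
    highBox = box (suc h +_) (suc h +_) q (4 * q)
    topBox  = box (suc h + q +_) (suc h + 2 * q +_) q (2 * q)
    largePoints = lowBox ++ midBox ++ highBox ++ topBox

    length-largePoints : length largePoints ≡ 18 * (q * q)
    length-largePoints = trans (trans (length-++ lowBox) (cong₂ _+_ (length-box _ _ (2 * q) (2 * q))
      (trans (length-++ midBox) (cong₂ _+_ (length-box _ _ (2 * q) (4 * q))
        (trans (length-++ highBox) (cong₂ _+_ (length-box _ _ q (4 * q)) (length-box _ _ q (2 * q))))))))
      (lem q)
      where
      lem : ∀ q → 2 * q * (2 * q) + (2 * q * (4 * q) + (q * (4 * q) + q * (2 * q))) ≡ 18 * (q * q)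
      lem = solve-∀

    ∈-low : ∀ {s} → s ∈ lowBox → Large s × proj₁ s < 2 * q
    ∈-low s∈ with _ , _ , i< , w< , refl ← ∈-box _ _ (2 * q) (2 * q) s∈ = low i< w< , i<

    ∈-mid : ∀ {s} → s ∈ midBox → Large s × 2 * q ≤ proj₁ s × proj₁ s < suc h
    ∈-mid s∈ with i , _ , i< , w< , refl ← ∈-box _ _ (2 * q) (4 * q) s∈ =
      mid i< w< , m≤m+n (2 * q) i , s≤s (<4q⇒≤h (2q+<4q i<))

    ∈-high : ∀ {s} → s ∈ highBox → Large s × suc h ≤ proj₁ s × proj₁ s < suc h + q
    ∈-high s∈ with d , _ , d< , v< , refl ← ∈-box _ _ q (4 * q) s∈ =
      high d< v< , m≤m+n (suc h) d , +-monoʳ-< (suc h) d<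

    ∈-top : ∀ {s} → s ∈ topBox → Large s × suc h + q ≤ proj₁ s
    ∈-top s∈ with d , _ , d< , v< , refl ← ∈-box _ _ q (2 * q) s∈ =
      top d< v< , m≤m+n (suc h + q) d

    ∈-high++top : ∀ {s} → s ∈ highBox ++ topBox → Large s × suc h ≤ proj₁ s
    ∈-high++top s∈ with ∈-++⁻ highBox s∈
    ... | inj₁ s∈ = let L , h< , _ = ∈-high s∈ in L , h<
    ... | inj₂ s∈ = let L , h< = ∈-top s∈ in L , ≤-trans (m≤m+n (suc h) q) h<

    ∈-mid++high++top : ∀ {s} → s ∈ midBox ++ highBox ++ topBox → Large s × 2 * q ≤ proj₁ s
    ∈-mid++high++top s∈ with ∈-++⁻ midBox s∈
    ... | inj₁ s∈ = let L , 2q≤ , _ = ∈-mid s∈ in L , 2q≤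
    ... | inj₂ s∈ = let L , h< = ∈-high++top s∈ in L , ≤-trans 2q≤h (<⇒≤ h<)

    ∈-large : ∀ {s} → s ∈ largePoints → Large s
    ∈-large s∈ with ∈-++⁻ lowBox s∈
    ... | inj₁ s∈ = proj₁ (∈-low s∈)
    ... | inj₂ s∈ = proj₁ (∈-mid++high++top s∈)

    -- The boxes occupy successive ranges of columns, with cuts at `2 * q`, `suc h` and `suc h + q`.
    unique-largePoints : Unique largePoints
    unique-largePoints =
      unique-++-separated (2 * q) (λ s∈ → proj₂ (∈-low s∈)) (λ s∈ → proj₂ (∈-mid++high++top s∈))
        (unique-box (2 * q) (2 * q) (λ eq → eq) (*-cancelˡ-≡ _ _ 2))
      (unique-++-separated (suc h) (λ s∈ → proj₂ (proj₂ (∈-mid s∈))) (λ s∈ → proj₂ (∈-high++top s∈))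
        (unique-box (2 * q) (4 * q) (+-cancelˡ-≡ (2 * q) _ _) (*-cancelˡ-≡ _ _ 2))
      (unique-++-separated (suc h + q) (λ s∈ → proj₂ (proj₂ (∈-high s∈))) (λ s∈ → proj₂ (∈-top s∈))
        (unique-box q (4 * q) (+-cancelˡ-≡ (suc h) _ _) (+-cancelˡ-≡ (suc h) _ _))
        (unique-box q (2 * q) (+-cancelˡ-≡ (suc h + q) _ _) (+-cancelˡ-≡ (suc h + 2 * q) _ _))))

    largeBlock : NatBlock h
    largeBlock = record
      { points = largePoints
      ; unique = unique-largePoints
      ; shape  = λ s∈ → large-shape (∈-large s∈)
      ; noWrap = λ s∈ t∈ u∈ → large-noWrap (∈-large s∈) (∈-large t∈) (∈-large u∈)
      }

  -- Density at least 101/400 for every odd modulus.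

  Dense : ∀ {h} → NatBlock h → Set
  Dense {h} block = 101 * (suc (2 * h) * suc (2 * h)) ≤ 400 * length (NatBlock.points block)

  -- 400(h + 1)² - 101(2h + 1)² equals 4h(99 - h) + 299, whence the threshold 99. Adding 4h² to both
  -- sides keeps the computation in ℕ.
  small-dense : ∀ {h} → h ≤ 99 → Dense (smallBlock h)
  small-dense {h} h≤99 = +-cancelʳ-≤ (4 * (h * h)) _ _ (begin
    101 * (suc (2 * h) * suc (2 * h)) + 4 * (h * h)
      ≤⟨ +-monoʳ-≤ (101 * (suc (2 * h) * suc (2 * h))) (*-monoʳ-≤ 4 (*-monoˡ-≤ h h≤99)) ⟩
    101 * (suc (2 * h) * suc (2 * h)) + 4 * (99 * h)
      ≤⟨ m≤m+n _ 299 ⟩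
    101 * (suc (2 * h) * suc (2 * h)) + 4 * (99 * h) + 299
      ≡⟨ lem h ⟩
    400 * (suc h * suc h) + 4 * (h * h)
      ≡⟨ cong (λ l → 400 * l + 4 * (h * h)) (length-box (λ i → i) (2 *_) (suc h) (suc h)) ⟨
    400 * length (NatBlock.points (smallBlock h)) + 4 * (h * h) ∎)
    where
    open ≤-Reasoning
    lem : ∀ h → 101 * (suc (2 * h) * suc (2 * h)) + 4 * (99 * h) + 299 ≡ 400 * (suc h * suc h) + 4 * (h * h)
    lem = solve-∀

  -- Here p ≤ 8q + 7, and `100 ≤ h` forces q ≥ 18, so 5p ≤ 40q + 35 ≤ 42q. After scaling by 25 the
  -- claim becomes 101 · 42² = 178164 ≤ 180000 = 25 · 400 · 18.
  large-dense : ∀ {q h} (4q≤h : 4 * q ≤ h) → h ≤ 3 + 4 * q → 100 ≤ h → Dense (largeBlock q h 4q≤h)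
  large-dense {q} {h} 4q≤h h≤ 100≤h = *-cancelˡ-≤ 25 (begin
    25 * (101 * (p * p))          ≡⟨ lem p ⟩
    101 * ((5 * p) * (5 * p))     ≤⟨ *-monoʳ-≤ 101 (*-mono-≤ 5p≤42q 5p≤42q) ⟩
    101 * ((42 * q) * (42 * q))   ≡⟨ lem₁ q ⟩
    178164 * (q * q)              ≤⟨ *-monoˡ-≤ (q * q) (≤ᵇ⇒≤ 178164 180000 _) ⟩
    180000 * (q * q)              ≡⟨ lem₂ (q * q) ⟩
    25 * (400 * (18 * (q * q)))   ≡⟨ cong (λ l → 25 * (400 * l)) (length-largePoints q h 4q≤h) ⟨
    25 * (400 * length (largePoints q h 4q≤h)) ∎)
    where
    open ≤-Reasoning
    p = suc (2 * h)
    lem : ∀ p → 25 * (101 * (p * p)) ≡ 101 * ((5 * p) * (5 * p))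
    lem = solve-∀
    lem₁ : ∀ q → 101 * ((42 * q) * (42 * q)) ≡ 178164 * (q * q)
    lem₁ q = trans (cong (101 *_) ([m*n]*[o*p]≡[m*o]*[n*p] 42 q 42 q)) (sym (*-assoc 101 1764 (q * q)))
    lem₂ : ∀ k → 180000 * k ≡ 25 * (400 * (18 * k))
    lem₂ k = trans (*-assoc 10000 18 k) (*-assoc 25 400 (18 * k))
    lem₃ : ∀ q → 5 * suc (2 * (3 + 4 * q)) ≡ 35 + 40 * q
    lem₃ = solve-∀
    18≤q : 18 ≤ q
    18≤q = ≮⇒≥ λ q<18 → <⇒≱ (≤-<-trans (≤-trans h≤ (+-monoʳ-≤ 3 (*-monoʳ-≤ 4 (s≤s⁻¹ q<18)))) (≤ᵇ⇒≤ 72 100 _)) 100≤h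
    5p≤42q : 5 * p ≤ 42 * q
    5p≤42q = begin
      5 * suc (2 * h)             ≤⟨ *-monoʳ-≤ 5 (s≤s (*-monoʳ-≤ 2 h≤)) ⟩
      5 * suc (2 * (3 + 4 * q))   ≡⟨ lem₃ q ⟩
      35 + 40 * q                 ≤⟨ +-monoˡ-≤ (40 * q) (≤-trans (n≤1+n 35) (*-monoʳ-≤ 2 18≤q)) ⟩
      2 * q + 40 * q              ≡⟨ *-distribʳ-+ q 2 40 ⟨
      42 * q                      ∎

  dense-block : ∀ h → Σ[ block ∈ NatBlock h ] Dense block
  dense-block h with ≤-<-connex h 99
  ... | inj₁ h≤99  = smallBlock h , small-dense h≤99
  ... | inj₂ 100≤h = largeBlock (h / 4) h 4q≤h , large-dense {h / 4} {h} 4q≤h h≤ 100≤h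
    where
    split : h ≡ h % 4 + 4 * (h / 4)
    split = trans (m≡m%n+[m/n]*n h 4) (cong (h % 4 +_) (*-comm (h / 4) 4))
    4q≤h : 4 * (h / 4) ≤ h
    4q≤h = ≤-trans (m≤n+m _ (h % 4)) (≤-reflexive (sym split))
    h≤ : h ≤ 3 + 4 * (h / 4)
    h≤ = ≤-trans (≤-reflexive split) (+-monoˡ-≤ (4 * (h / 4)) (s≤s⁻¹ (m%n<n h 4)))

  -- Trading surplus density for the losses in the level-set bound.

  ^-≤-square-half : ∀ a n .{{_ : NonZero a}} → a ^ n ≤ (a * a) ^ ⌊ n /2⌋ * a
  ^-≤-square-half a 0 = ≤-trans (>-nonZero⁻¹ a) (≤-reflexive (sym (+-identityʳ a)))
  ^-≤-square-half a 1 = ≤-reflexive (*-comm a 1)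
  ^-≤-square-half a (suc (suc n)) = begin
    a * (a * a ^ n)                       ≡⟨ *-assoc a a (a ^ n) ⟨
    a * a * a ^ n                         ≤⟨ *-monoʳ-≤ (a * a) (^-≤-square-half a n) ⟩
    a * a * ((a * a) ^ ⌊ n /2⌋ * a)       ≡⟨ *-assoc (a * a) ((a * a) ^ ⌊ n /2⌋) a ⟨
    a * a * (a * a) ^ ⌊ n /2⌋ * a         ∎
    where open ≤-Reasoning

  square-half-≤-^ : ∀ b n .{{_ : NonZero b}} → (b * b) ^ ⌊ n /2⌋ ≤ b ^ n
  square-half-≤-^ b 0 = ≤-refl
  square-half-≤-^ b 1 = ≤-trans (>-nonZero⁻¹ b) (≤-reflexive (sym (*-identityʳ b)))
  square-half-≤-^ b (suc (suc n)) =
    ≤-trans (*-monoʳ-≤ (b * b) (square-half-≤-^ b n)) (≤-reflexive (*-assoc b b (b ^ n)))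

  ^-distribʳ-* : ∀ n a b → (a * b) ^ n ≡ a ^ n * b ^ n
  ^-distribʳ-* zero    a b = refl
  ^-distribʳ-* (suc n) a b = trans (cong (a * b *_) (^-distribʳ-* n a b))
    ([m*n]*[o*p]≡[m*o]*[n*p] a b (a ^ n) (b ^ n))

  module _ (a b s K L m B : ℕ) .{{_ : NonZero K}}
           (gain   : a * a * suc K ≤ b * b * (K * s))
           (large  : s ^ m ≤ L * suc (m * B))
           (growth : K ^ m * (a * suc (m * B)) ≤ suc K ^ m)
           where

    -- The m-th power of `gain` leaves a spare factor (1 + 1/K)^m. By `growth` it pays both for the
    -- number `suc (m * B)` of levels and for the single `a` due to an odd dimension.
    absorb-loss : (a * a) ^ m * a ≤ L * (b * b) ^ m
    absorb-loss = *-cancelʳ-≤ _ _ (K ^ m * Q) {{m*n≢0 (K ^ m) Q {{m^n≢0 K m}}}} (begin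
      (a * a) ^ m * a * (K ^ m * Q)       ≡⟨ rotate ((a * a) ^ m) a (K ^ m) Q ⟩
      (a * a) ^ m * (K ^ m * (a * Q))     ≤⟨ *-monoʳ-≤ ((a * a) ^ m) growth ⟩
      (a * a) ^ m * suc K ^ m             ≡⟨ ^-distribʳ-* m (a * a) (suc K) ⟨
      (a * a * suc K) ^ m                 ≤⟨ ^-monoˡ-≤ m gain ⟩
      (b * b * (K * s)) ^ m               ≡⟨ ^-distribʳ-* m (b * b) (K * s) ⟩
      (b * b) ^ m * (K * s) ^ m           ≡⟨ cong ((b * b) ^ m *_) (^-distribʳ-* m K s) ⟩
      (b * b) ^ m * (K ^ m * s ^ m)       ≤⟨ *-monoʳ-≤ ((b * b) ^ m) (*-monoʳ-≤ (K ^ m) large) ⟩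
      (b * b) ^ m * (K ^ m * (L * Q))     ≡⟨ rotate′ ((b * b) ^ m) (K ^ m) L Q ⟩
      L * (b * b) ^ m * (K ^ m * Q)       ∎)
      where
      open ≤-Reasoning
      Q = suc (m * B)
      rotate : ∀ x a k q → x * a * (k * q) ≡ x * (k * (a * q))
      rotate = solve-∀
      rotate′ : ∀ y k l q → y * (k * (l * q)) ≡ l * y * (k * q)
      rotate′ = solve-∀

  -- Transfer between natural and rational inequalities.

  fromℕ : ℕ → ℚ
  fromℕ k = ℤ.+ k ℚ./ 1

  -- Checked on unnormalised fractions, where a product computes without reduction to lowest terms.
  fromℕ-* : ∀ a b → fromℕ a ℚ.* fromℕ b ≡ fromℕ (a * b)
  fromℕ-* a b = ℚ.toℚᵘ-injective (begin-equality
    toℚᵘ (fromℕ a ℚ.* fromℕ b)                ≃⟨ ℚ.toℚᵘ-homo-* (fromℕ a) (fromℕ b) ⟩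
    toℚᵘ (fromℕ a) ℚᵘ.* toℚᵘ (fromℕ b)        ≃⟨ ℚᵘ.*-cong (ℚ.toℚᵘ-fromℚᵘ (ℚᵘ.mkℚᵘ (ℤ.+ a) 0)) (ℚ.toℚᵘ-fromℚᵘ (ℚᵘ.mkℚᵘ (ℤ.+ b) 0)) ⟩
    ℚᵘ.mkℚᵘ (ℤ.+ a ℤ.* ℤ.+ b) 0               ≡⟨ cong (λ k → ℚᵘ.mkℚᵘ k 0) (ℤ.pos-* a b) ⟨
    ℚᵘ.mkℚᵘ (ℤ.+ (a * b)) 0                 ≃⟨ ℚ.toℚᵘ-fromℚᵘ (ℚᵘ.mkℚᵘ (ℤ.+ (a * b)) 0) ⟨
    toℚᵘ (fromℕ (a * b))                      ∎)
    where open ℚᵘ.≤-Reasoning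

  fromℕ-mono : ∀ {a b} → a ≤ b → fromℕ a ℚ.≤ fromℕ b
  fromℕ-mono {a} {b} a≤b = ℚ.toℚᵘ-cancel-≤ (begin
    toℚᵘ (fromℕ a)         ≃⟨ ℚ.toℚᵘ-fromℚᵘ (ℚᵘ.mkℚᵘ (ℤ.+ a) 0) ⟩
    ℚᵘ.mkℚᵘ (ℤ.+ a) 0      ≤⟨ ℚᵘ.*≤* (ℤ.*-monoʳ-≤-nonNeg (ℤ.+ 1) (ℤ.+≤+ a≤b)) ⟩
    ℚᵘ.mkℚᵘ (ℤ.+ b) 0      ≃⟨ ℚ.toℚᵘ-fromℚᵘ (ℚᵘ.mkℚᵘ (ℤ.+ b) 0) ⟨
    toℚᵘ (fromℕ b)         ∎)
    where open ℚᵘ.≤-Reasoning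

  fraction-^ : ∀ {x a b} → x ℚ.* fromℕ b ≡ fromℕ a → ∀ n → (x ^ℚ n) ℚ.* fromℕ (b ^ n) ≡ fromℕ (a ^ n)
  fraction-^ eq zero = refl
  fraction-^ {x} {a} {b} eq (suc n) = begin
    x ℚ.* x ^ℚ n ℚ.* fromℕ (b * b ^ n)              ≡⟨ cong (x ℚ.* x ^ℚ n ℚ.*_) (fromℕ-* b (b ^ n)) ⟨
    x ℚ.* x ^ℚ n ℚ.* (fromℕ b ℚ.* fromℕ (b ^ n))    ≡⟨ interchange x (x ^ℚ n) (fromℕ b) (fromℕ (b ^ n)) ⟩
    x ℚ.* fromℕ b ℚ.* (x ^ℚ n ℚ.* fromℕ (b ^ n))    ≡⟨ cong₂ ℚ._*_ eq (fraction-^ eq n) ⟩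
    fromℕ a ℚ.* fromℕ (a ^ n)                        ≡⟨ fromℕ-* a (a ^ n) ⟩
    fromℕ (a * a ^ n)                                ∎
    where
    open ≡-Reasoning
    open import Algebra.Properties.CommutativeSemigroup
      (CommutativeMonoid.commutativeSemigroup ℚ.*-1-commutativeMonoid) using (interchange)

  fraction-^-≤ : ∀ x a b L .{{_ : NonZero b}} → x ℚ.* fromℕ b ≡ fromℕ a →
                 ∀ n → a ^ n ≤ L * b ^ n → x ^ℚ n ℚ.≤ fromℕ L
  fraction-^-≤ x a b L eq n aⁿ≤ = ℚ.*-cancelʳ-≤-pos (fromℕ (b ^ n))
    {{ℚ.normalize-pos (b ^ n) 1 {{_}} {{m^n≢0 b n}}}} (begin
      (x ^ℚ n) ℚ.* fromℕ (b ^ n)    ≡⟨ fraction-^ eq n ⟩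
      fromℕ (a ^ n)                  ≤⟨ fromℕ-mono aⁿ≤ ⟩
      fromℕ (L * b ^ n)              ≡⟨ fromℕ-* L (b ^ n) ⟨
      fromℕ L ℚ.* fromℕ (b ^ n)      ∎)
    where open ℚ.≤-Reasoning

  -- The fraction a/b plays the role of c · p. The exponent of the block is ⌊n/2⌋, hence the
  -- threshold `2 * m₀`.
  eventually-large : ∀ {p a b K} .{{_ : NonZero p}} .{{_ : NonZero a}} .{{_ : NonZero b}} .{{_ : NonZero K}}
    (block : ConvexBlock p) → a * a * suc K ≤ b * b * (K * length (ConvexBlock.points block)) →
    ∃[ n₀ ] ∀ n → n ≥ n₀ → a ^ n ≤ length (APFree.elements (lift p block n)) * b ^ n
  eventually-large {p} {a} {b} {K} block gain = 2 * m₀ , enough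
    where
    open ConvexBlock block using (bound; points)
    growth = exponential-beats-linear K a bound
    m₀ = proj₁ growth
    enough : ∀ n → n ≥ 2 * m₀ → a ^ n ≤ length (APFree.elements (lift p block n)) * b ^ n
    enough n n≥ = begin
      a ^ n                                  ≤⟨ ^-≤-square-half a n ⟩
      (a * a) ^ ⌊ n /2⌋ * a                  ≤⟨ absorb-loss a b (length points) K (length elements) ⌊ n /2⌋ bound
                                                  gain large (proj₂ growth ⌊ n /2⌋ m≥m₀) ⟩
      length elements * (b * b) ^ ⌊ n /2⌋    ≤⟨ *-monoʳ-≤ (length elements) (square-half-≤-^ b n) ⟩
      length elements * b ^ n                ∎
      where
      open ≤-Reasoning
      open APFree (lift p block n)
      m≥m₀ : ⌊ n /2⌋ ≥ m₀
      m≥m₀ = subst (_≤ ⌊ n /2⌋) (⌊2n/2⌋≡n m₀) (⌊n/2⌋-mono n≥)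

  -- The prime 2 and the parity of primes.

  allVectors : ∀ p n → List (𝔽^ p n)
  allVectors p zero    = [ [] ]
  allVectors p (suc n) = cartesianProductWith _∷_ (allFin p) (allVectors p n)

  allVectors-unique : ∀ p n → Unique (allVectors p n)
  allVectors-unique p zero    = [] AllPairs.∷ AllPairs.[]
  allVectors-unique p (suc n) =
    Unique.cartesianProductWith⁺ _∷_ ∷-injective (Unique.allFin⁺ p) (allVectors-unique p n)

  length-allVectors : ∀ p n → length (allVectors p n) ≡ p ^ n
  length-allVectors p zero    = refl
  length-allVectors p (suc n) = trans (length-cartesianProductWith _∷_ (allFin p) (allVectors p n))
    (cong₂ _*_ (length-tabulate {n = p} (λ i → i)) (length-allVectors p n))

  -- Modulo 2 the term 2y vanishes and x + z = 0 means x = z.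
  ap-mod-2 : ∀ x y z → AP 2 x y z → x ≡ z
  ap-mod-2 zero       _          zero       _  = refl
  ap-mod-2 (suc zero) _          (suc zero) _  = refl
  ap-mod-2 zero       zero       (suc zero) ()
  ap-mod-2 zero       (suc zero) (suc zero) ()
  ap-mod-2 (suc zero) zero       zero       ()
  ap-mod-2 (suc zero) (suc zero) zero       ()

  vector-ap-mod-2 : ∀ {n} (x y z : 𝔽^ 2 n) → x -ᵥ fromℕₚ 2 ·ᵥ y +ᵥ z ≡ 0ᵥ → x ≡ z
  vector-ap-mod-2 []      []      []      _  = refl
  vector-ap-mod-2 (a ∷ x) (b ∷ y) (d ∷ z) ap = let ap₁ , ap₂ = ∷-injective ap in
    cong₂ _∷_ (ap-mod-2 a b d ap₁) (vector-ap-mod-2 x y z ap₂)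

  even-or-odd : ∀ n → ∃[ h ] (n ≡ 2 * h ⊎ n ≡ suc (2 * h))
  even-or-odd zero = 0 , inj₁ refl
  even-or-odd (suc n) with even-or-odd n
  ... | h , inj₁ refl = h , inj₂ refl
  ... | h , inj₂ refl = suc h , inj₁ (sym (*-suc 2 h))

  prime-2-or-odd : ∀ {p} → Prime p → p ≡ 2 ⊎ ∃[ h ] p ≡ suc (2 * h)
  prime-2-or-odd {p} pr with even-or-odd p
  ... | h , inj₂ odd  = inj₂ (h , odd)
  ... | h , inj₁ even with prime⇒irreducible pr (divides h (trans even (*-comm 2 h)))
  ...   | inj₂ 2≡p = inj₁ (sym 2≡p)

  -- The bound for all primes, with the constants kept as parameters.

  module _ {c : ℚ} {num den K α β : ℕ}
           .{{_ : NonZero num}} .{{_ : NonZero den}} .{{_ : NonZero K}} .{{_ : NonZero β}}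
           (c≡num/den : c ℚ.* fromℕ den ≡ fromℕ num)
           -- The factor suc K / K absorbs the loss in the pigeonhole step.
           (room : num * num * suc K * β ≤ den * den * K * α)
           where

    Conclusion : (p : ℕ) .{{_ : NonZero p}} → ℕ → Set
    Conclusion p n = Σ[ A ∈ List (𝔽^ p n) ]
      Unique A × (c ℚ.* fromℕ p) ^ℚ n ℚ.≤ fromℕ (length A) × ThreeTermAPFree A

    c*p≡ : ∀ p → c ℚ.* fromℕ p ℚ.* fromℕ den ≡ fromℕ (num * p)
    c*p≡ p = begin
      c ℚ.* fromℕ p ℚ.* fromℕ den       ≡⟨ ℚ.*-assoc c (fromℕ p) (fromℕ den) ⟩
      c ℚ.* (fromℕ p ℚ.* fromℕ den)     ≡⟨ cong (c ℚ.*_) (ℚ.*-comm (fromℕ p) (fromℕ den)) ⟩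
      c ℚ.* (fromℕ den ℚ.* fromℕ p)     ≡⟨ ℚ.*-assoc c (fromℕ den) (fromℕ p) ⟨
      c ℚ.* fromℕ den ℚ.* fromℕ p       ≡⟨ cong (ℚ._* fromℕ p) c≡num/den ⟩
      fromℕ num ℚ.* fromℕ p             ≡⟨ fromℕ-* num p ⟩
      fromℕ (num * p)                   ∎
      where open ≡-Reasoning

    dense⇒conclusion : ∀ p .{{_ : NonZero p}} (block : ConvexBlock p) →
      α * (p * p) ≤ β * length (ConvexBlock.points block) →
      ∃[ n₀ ] ∀ n → n ≥ n₀ → Conclusion p n
    dense⇒conclusion p block dense = proj₁ eventually , conclude
      where
      s = length (ConvexBlock.points block)
      gain : (num * p) * (num * p) * suc K ≤ den * den * (K * s)
      gain = *-cancelʳ-≤ _ _ β (begin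
        (num * p) * (num * p) * suc K * β      ≡⟨ lem num p (suc K) β ⟩
        num * num * suc K * β * (p * p)        ≤⟨ *-monoˡ-≤ (p * p) room ⟩
        den * den * K * α * (p * p)            ≡⟨ *-assoc (den * den * K) α (p * p) ⟩
        den * den * K * (α * (p * p))          ≤⟨ *-monoʳ-≤ (den * den * K) dense ⟩
        den * den * K * (β * s)                ≡⟨ lem′ (den * den) K β s ⟩
        den * den * (K * s) * β                ∎)
        where
        open ≤-Reasoning
        lem : ∀ x p k β → (x * p) * (x * p) * k * β ≡ x * x * k * β * (p * p)
        lem = solve-∀
        lem′ : ∀ x k β s → x * k * (β * s) ≡ x * (k * s) * β
        lem′ = solve-∀
      eventually = eventually-large {p} {num * p} {den} {K} {{_}} {{m*n≢0 num p}} block gain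
      conclude : ∀ n → n ≥ proj₁ eventually → Conclusion p n
      conclude n n≥ = elements , distinct , fraction-^-≤ (c ℚ.* fromℕ p) (num * p) den (length elements)
        (c*p≡ p) n (proj₂ eventually n n≥) , apFree
        where open APFree (lift p block n)

    odd-case : ∀ {h} (block : NatBlock h) →
               α * (suc (2 * h) * suc (2 * h)) ≤ β * length (NatBlock.points block) →
               ∃[ n₀ ] ∀ n → n ≥ n₀ → Conclusion (suc (2 * h)) n
    odd-case {h} block dense = dense⇒conclusion (suc (2 * h)) (convexBlock block)
      (≤-trans dense (≤-reflexive (cong (β *_) (sym (length-map (fromℕ² {h}) (NatBlock.points block))))))

    -- The set has all 2^n elements, so c ≤ 1 gives (2c)^n ≤ 2^n.
    two-case : num ≤ den → ∀ n → Conclusion 2 n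
    two-case num≤den n = allVectors 2 n , allVectors-unique 2 n
      , subst (λ l → (c ℚ.* fromℕ 2) ^ℚ n ℚ.≤ fromℕ l) (sym (length-allVectors 2 n))
          (fraction-^-≤ (c ℚ.* fromℕ 2) (num * 2) den (2 ^ n) (c*p≡ 2) n enough)
      , λ {x} {y} {z} _ _ _ (_ , _ , x≢z , ap) → x≢z (vector-ap-mod-2 x y z ap)
      where
      open ≤-Reasoning
      enough : (num * 2) ^ n ≤ 2 ^ n * den ^ n
      enough = begin
        (num * 2) ^ n      ≤⟨ ^-monoˡ-≤ n (≤-trans (*-monoˡ-≤ 2 num≤den) (≤-reflexive (*-comm den 2))) ⟩
        (2 * den) ^ n      ≡⟨ ^-distribʳ-* n 2 den ⟩
        2 ^ n * den ^ n    ∎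

    conclusion : (∀ h → Σ[ block ∈ NatBlock h ]
                    α * (suc (2 * h) * suc (2 * h)) ≤ β * length (NatBlock.points block)) →
                 num ≤ den → ∀ p .{{_ : NonZero p}} → Prime p → ∃[ n₀ ] ∀ n → n ≥ n₀ → Conclusion p n
    conclusion blocks num≤den p isPrime with prime-2-or-odd isPrime
    ... | inj₁ refl       = 0 , λ n _ → two-case num≤den n
    ... | inj₂ (h , refl) = let block , dense = blocks h in odd-case block dense

open import Data.Integer.Base using (+_)
open import Data.List.Base using (List; length)
open import Data.List.Relation.Unary.Unique.Propositional using (Unique)
open import Data.Nat.Base using (ℕ; NonZero; _≥_)
open import Data.Nat.Primality using (Prime)
open import Data.Product.Base using (Σ-syntax; _×_; _,_)
open import Data.Rational.Base using (ℚ; ½; _/_; _*_; _<_; _≤_; +-*-rawSemiring)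
open import Algebra.Definitions.RawSemiring +-*-rawSemiring using (_^_)
open import Data.Nat.Properties using (≤ᵇ⇒≤)
open import Data.Rational.Properties using (_<?_)
open import Relation.Binary.PropositionalEquality using (refl)
open import Relation.Nullary.Decidable using (from-yes)
open import Defs

theorem1p1 : Σ[ c ∈ ℚ ] ½ < c × (∀ (p : ℕ) .{{_ : NonZero p}} → Prime p →
    Σ[ n₀ ∈ ℕ ] (∀ (n : ℕ) → n ≥ n₀ →
    Σ[ A ∈ List (𝔽^ p n) ]
    Unique A × (c * (+ p / 1)) ^ n ≤ + length A / 1 × ThreeTermAPFree A))
-- The density 101/400 is 1.01 times 1/4. Since 1.001² · 201/200 is about 1.007, it leaves room for
-- c = 1001/2000 and for the growth factor 201/200 given by `K` = 200.
theorem1p1 = + 1001 / 2000 , from-yes (½ <? + 1001 / 2000) ,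
  Construction.conclusion {num = 1001} {2000} {200} {101} {400}
    refl (≤ᵇ⇒≤ _ _ _) Construction.dense-block (≤ᵇ⇒≤ _ _ _)
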